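{- Let $r\ge2$ be an integer and $\gamma>0$. There exists $n_0=n_0(r,\gamma)\in\mathbb N$ such that the following holds for all $n\ge n_0$. Suppose $G$ is an $n$-vertex digraph such that for all distinct $x,y\in V(G)$ at least one of the following holds: (i) $xy,yx\in E(G)$; (ii) $d^*_G(z)\ge(1-1/r+\gamma)n$ for some $z\in\{x,y\}$. Then $G$ contains a $T_r$-tiling covering all but at most $\gamma n$ vertices of $G$.
   Context: Digraphs have no loops and at most one edge in each direction between any pair of vertices. The dominant degree of $z$ is $d^*_G(z):=\max\{d^+_G(z),d^-_G(z)\}$ (max of out-degree and in-degree). $T_r$ is the transitive tournament on $r$ vertices; a $T_r$-tiling is a collection of vertex-disjoint copies of $T_r$. -}

module Defs where

open import Data.Nat using (ℕ; zero; suc; _+_; _*_; _∸_; _⊔_; _<_; _≤_)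
open import Data.Fin using (Fin; zero; suc; _<_)
open import Data.Bool using (Bool; true; false)
open import Data.Integer using (+_)
open import Data.Rational using (ℚ; _/_; 0ℚ)
open import Data.Product using (_×_; _,_)
open import Function.Definitions using (Injective)
open import Relation.Binary.PropositionalEquality using (_≡_)

-- A digraph on vertex set Fin n: a Boolean adjacency relation with no loops.
-- (At most one edge per direction is automatic: adj x y is a Bool.)
record Digraph (n : ℕ) : Set where
  field
    adj      : Fin n → Fin n → Bool
    loopless : ∀ x → adj x x ≡ false
open Digraph public

Edge : ∀ {n} → Digraph n → Fin n → Fin n → Set
Edge G x y = adj G x y ≡ true

countᵇ : ∀ {n} → (Fin n → Bool) → ℕ
countᵇ {zero}  f = 0
countᵇ {suc n} f with f zero
... | true  = suc (countᵇ (λ i → f (suc i)))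
... | false = countᵇ (λ i → f (suc i))

outdeg indeg domdeg : ∀ {n} → Digraph n → Fin n → ℕ
outdeg G z = countᵇ (λ y → adj G z y)
indeg  G z = countᵇ (λ y → adj G y z)
domdeg G z = outdeg G z ⊔ indeg G z

ℕ→ℚ : ℕ → ℚ
ℕ→ℚ n = + n / 1

-- 1/r as a rational (only used for r ≥ 2; value at r = 0 irrelevant)
inv : ℕ → ℚ
inv zero    = 0ℚ
inv (suc k) = + 1 / suc k

-- A T_r-tiling in G with k tiles: tile t is the image of Fin r under
-- emb (t , -), all vertices used are distinct (joint injectivity), and
-- for i < j in the transitive order there is an edge emb(t,i) → emb(t,j).
record Tiling {n : ℕ} (G : Digraph n) (r k : ℕ) : Set where
  field
    emb       : Fin k × Fin r → Fin n
    injective : Injective _≡_ _≡_ emb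
    edges     : ∀ t (i j : Fin r) → i Data.Fin.< j → Edge G (emb (t , i)) (emb (t , j))

{-# OPTIONS --safe #-}

-- Vertices without large dominant degree ("small" ones) span a complete digraph. Tiles are removed one
-- after the other, each chosen so that the set R of remaining vertices stays quasirandom with respect
-- to the sets M(z) of vertices outside the dominant neighbourhood of z. This is measured by the
-- potential Φ(R) = Σ_z e_z(R)², where e_z(R) = n |M(z) ∩ R| − |R| |M(z)|. While |R| ≥ γn, a potential
-- of order n⁴ leaves only boundedly many exceptional non-small z that miss more than about |R|/r
-- vertices of R. Outside them, a greedy choice produces, for every cost function on the vertices, a T_r
-- of cost at most about r times the average cost (the dual form of a fractional tiling). With the
-- first-order change of Φ as the cost, removing this T_r raises Φ by only O(n³), and Φ starts at 0.
module Submission where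

open import Defs

-- Integer sums over lists, and inequalities certified by ring identities.

module ListSums where

  open import Data.Bool using (Bool; true; false)
  open import Data.Integer using (ℤ; +_; -[1+_]; 0ℤ; 1ℤ; _+_; _-_; _*_; -_; _≤_; +≤+; +<+; nonNegative; positive)
  open import Data.Integer.Properties
  open import Data.Integer.Tactic.RingSolver using (solve-∀)
  open import Data.List using (List; []; _∷_; _++_; length)
  open import Data.List.Relation.Binary.Permutation.Propositional using (_↭_; refl; prep; swap; ↭-sym) renaming (trans to _⟫_)
  open import Data.List.Relation.Binary.Permutation.Propositional.Properties using (shift)
  open import Data.List.Relation.Unary.All as All using (All; []; _∷_)
  open import Data.Sum using (inj₁; inj₂)
  open import Data.Nat using (z≤n; s≤s)
  open import Data.Product using (Σ; _×_; _,_)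
  open import Relation.Binary.PropositionalEquality using (_≡_; refl; sym; trans; cong; cong₂; subst)

  0≤+ : ∀ {i j} → 0ℤ ≤ i → 0ℤ ≤ j → 0ℤ ≤ i + j
  0≤+ = +-mono-≤

  0≤* : ∀ {i j} → 0ℤ ≤ i → 0ℤ ≤ j → 0ℤ ≤ i * j
  0≤* {i} {j} 0≤i 0≤j =
    subst (_≤ i * j) (*-zeroʳ i) (*-monoˡ-≤-nonNeg i ⦃ nonNegative 0≤i ⦄ 0≤j)

  0≤square : ∀ i → 0ℤ ≤ i * i
  0≤square (+ n)    = 0≤* {+ n} {+ n} (+≤+ z≤n) (+≤+ z≤n)
  0≤square -[1+ n ] = +≤+ z≤n

  -- An inequality follows from a ring identity that exhibits the difference of its sides as nonnegative.
  infix 1 _⊢_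
  _⊢_ : ∀ {i j d} → j - i ≡ d → 0ℤ ≤ d → i ≤ j
  eq ⊢ 0≤d = 0≤i-j⇒j≤i (subst (0ℤ ≤_) (sym eq) 0≤d)

  gap : ∀ {i j} → i ≤ j → 0ℤ ≤ j - i
  gap = i≤j⇒0≤j-i

  square-≤ : ∀ {i j} → - j ≤ i → i ≤ j → i * i ≤ j * j
  square-≤ {i} {j} -j≤i i≤j = eq i j ⊢ 0≤* (gap i≤j) (gap -j≤i)
    where
    eq : ∀ i j → j * j - i * i ≡ (j - i) * (i - - j)
    eq = solve-∀

  [_] : Bool → ℤ
  [ true ]  = 1ℤ
  [ false ] = 0ℤ

  0≤[_] : ∀ b → 0ℤ ≤ [ b ]
  0≤[ true ]  = +≤+ z≤n
  0≤[ false ] = +≤+ z≤n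

  [_]≤1 : ∀ b → [ b ] ≤ 1ℤ
  [ true ]≤1  = ≤-refl
  [ false ]≤1 = +≤+ z≤n

  cancel-*ˡ-≤ : ∀ {i j} k → 1ℤ ≤ k → k * i ≤ k * j → i ≤ j
  cancel-*ˡ-≤ {i} {j} k 1≤k = *-cancelˡ-≤-pos i j k ⦃ positive (<-≤-trans (+<+ (s≤s z≤n)) 1≤k) ⦄

  1≤* : ∀ {i j} → 1ℤ ≤ i → 1ℤ ≤ j → 1ℤ ≤ i * j
  1≤* {i} {j} 1≤i 1≤j = eq i j ⊢ 0≤+ (0≤* (gap 1≤i) (≤-trans (+≤+ z≤n) 1≤j)) (gap 1≤j)
    where
    eq : ∀ i j → i * j - 1ℤ ≡ (i - 1ℤ) * j + (j - 1ℤ)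
    eq = solve-∀

  module _ {A : Set} where

    len : List A → ℤ
    len xs = + length xs

    0≤len : ∀ xs → 0ℤ ≤ len xs
    0≤len xs = +≤+ z≤n

    ∑ : (A → ℤ) → List A → ℤ
    ∑ f []       = 0ℤ
    ∑ f (x ∷ xs) = f x + ∑ f xs

    ∑-++ : ∀ f xs ys → ∑ f (xs ++ ys) ≡ ∑ f xs + ∑ f ys
    ∑-++ f []       ys = sym (+-identityˡ _)
    ∑-++ f (x ∷ xs) ys = trans (cong (_+_ (f x)) (∑-++ f xs ys)) (sym (+-assoc (f x) _ _))

    ∑-↭ : ∀ f {xs ys} → xs ↭ ys → ∑ f xs ≡ ∑ f ys
    ∑-↭ f refl         = refl
    ∑-↭ f (prep x p)   = cong (_+_ (f x)) (∑-↭ f p)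
    ∑-↭ f (swap x y p) rewrite ∑-↭ f p = exchange (f x) (f y) _
      where
      exchange : ∀ a b c → a + (b + c) ≡ b + (a + c)
      exchange = solve-∀
    ∑-↭ f (p ⟫ q)  = trans (∑-↭ f p) (∑-↭ f q)

    ∑-split : ∀ f {xs} ys zs → xs ↭ ys ++ zs → ∑ f xs ≡ ∑ f ys + ∑ f zs
    ∑-split f ys zs p = trans (∑-↭ f p) (∑-++ f ys zs)

    ∑-cong : ∀ {f g} → (∀ x → f x ≡ g x) → ∀ xs → ∑ f xs ≡ ∑ g xs
    ∑-cong f≗g []       = refl
    ∑-cong f≗g (x ∷ xs) = cong₂ _+_ (f≗g x) (∑-cong f≗g xs)

    ∑-mono : ∀ {f g xs} → All (λ x → f x ≤ g x) xs → ∑ f xs ≤ ∑ g xs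
    ∑-mono []       = ≤-refl
    ∑-mono (p ∷ ps) = +-mono-≤ p (∑-mono ps)

    ∑-const : ∀ a xs → ∑ (λ _ → a) xs ≡ len xs * a
    ∑-const a []       = sym (*-zeroˡ a)
    ∑-const a (x ∷ xs) = trans (cong (_+_ a) (∑-const a xs)) (sym (suc-* (len xs) a))

    ∑-≥ : ∀ {f a xs} → All (λ x → a ≤ f x) xs → len xs * a ≤ ∑ f xs
    ∑-≥ {a = a} {xs} ps = subst (_≤ _) (∑-const a xs) (∑-mono ps)

    ∑-≤ : ∀ {f a xs} → All (λ x → f x ≤ a) xs → ∑ f xs ≤ len xs * a
    ∑-≤ {a = a} {xs} ps = subst (_ ≤_) (∑-const a xs) (∑-mono ps)

    ∑-+ : ∀ f g xs → ∑ (λ x → f x + g x) xs ≡ ∑ f xs + ∑ g xs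
    ∑-+ f g []       = refl
    ∑-+ f g (x ∷ xs) rewrite ∑-+ f g xs = exchange (f x) (g x) _ _
      where
      exchange : ∀ a b c d → (a + b) + (c + d) ≡ (a + c) + (b + d)
      exchange = solve-∀

    ∑-*ˡ : ∀ a f xs → ∑ (λ x → a * f x) xs ≡ a * ∑ f xs
    ∑-*ˡ a f []       = sym (*-zeroʳ a)
    ∑-*ˡ a f (x ∷ xs) = trans (cong (_+_ (a * f x)) (∑-*ˡ a f xs)) (sym (*-distribˡ-+ a _ _))

    ∑-nonNeg : ∀ {f} → (∀ x → 0ℤ ≤ f x) → ∀ xs → 0ℤ ≤ ∑ f xs
    ∑-nonNeg 0≤f []       = ≤-refl
    ∑-nonNeg 0≤f (x ∷ xs) = 0≤+ (0≤f x) (∑-nonNeg 0≤f xs)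

    ∑-++ʳ : ∀ {f} → (∀ x → 0ℤ ≤ f x) → ∀ {xs} ys zs → xs ↭ ys ++ zs → ∑ f zs ≤ ∑ f xs
    ∑-++ʳ {f} 0≤f ys zs σ = subst (∑ f zs ≤_) (sym (∑-split f ys zs σ))
      (eq (∑ f ys) (∑ f zs) ⊢ ∑-nonNeg 0≤f ys)
      where
      eq : ∀ i j → (i + j) - j ≡ i
      eq = solve-∀

    count : (A → Bool) → List A → ℤ
    count p = ∑ (λ x → [ p x ])

    0≤count : ∀ p xs → 0ℤ ≤ count p xs
    0≤count p = ∑-nonNeg (λ x → 0≤[ p x ])

    count≤len : ∀ p xs → count p xs ≤ len xs
    count≤len p xs = subst (count p xs ≤_) (*-identityʳ (len xs)) (∑-≤ (All.universal (λ x → [ p x ]≤1) xs))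

    count-++ʳ : ∀ p {xs} ys zs → xs ↭ ys ++ zs → count p zs ≤ count p xs
    count-++ʳ p = ∑-++ʳ (λ x → 0≤[ p x ])

    split : ∀ (p : A → Bool) xs → Σ (List A) λ ys → Σ (List A) λ zs →
      xs ↭ ys ++ zs × All (λ y → p y ≡ false) ys × All (λ z → p z ≡ true) zs ×
      count p xs ≡ len zs
    split p []       = [] , [] , refl , [] , [] , refl
    split p (x ∷ xs) with split p xs | p x in px
    ... | ys , zs , σ , fs , ts , eq | true  =
      ys , x ∷ zs , prep x σ ⟫ ↭-sym (shift x ys zs) , fs , px ∷ ts ,
      cong (_+_ 1ℤ) eq
    ... | ys , zs , σ , fs , ts , eq | false =
      x ∷ ys , zs , prep x σ , px ∷ fs , ts , trans (+-identityˡ _) eq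

    extract-min : ∀ (f : A → ℤ) x xs → Σ A λ v → Σ (List A) λ ys →
      x ∷ xs ↭ v ∷ ys × All (λ y → f v ≤ f y) ys
    extract-min f x []       = x , [] , refl , []
    extract-min f x (y ∷ xs) with extract-min f y xs
    ... | v , ys , σ , mins with ≤-total (f x) (f v)
    ...   | inj₁ x≤v = x , v ∷ ys , prep x σ , x≤v ∷ All.map (≤-trans x≤v) mins
    ...   | inj₂ v≤x = v , x ∷ ys , prep x σ ⟫ swap x v refl , v≤x ∷ mins

  ∑-swap : ∀ {A B : Set} (f : A → B → ℤ) xs ys →
    ∑ (λ x → ∑ (f x) ys) xs ≡ ∑ (λ y → ∑ (λ x → f x y) xs) ys
  ∑-swap f []       ys = sym (trans (∑-const 0ℤ ys) (*-zeroʳ (len ys)))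
  ∑-swap f (x ∷ xs) ys =
    trans (cong (_+_ (∑ (f x) ys)) (∑-swap f xs ys)) (sym (∑-+ (f x) _ ys))

-- Lists up to permutation, read as finite sets.

module Permutations where

  open import Data.Integer using (+_; _+_)
  open import Data.List using (List; []; _∷_; _++_)
  open import Data.List.Properties using (length-++)
  open import Data.List.Relation.Binary.Permutation.Propositional using (_↭_; ↭⇒↭ₛ)
  open import Data.List.Relation.Binary.Permutation.Propositional.Properties using (All-resp-↭; ↭-length)
  import Data.List.Relation.Binary.Permutation.Setoid.Properties as Setoid
  open import Data.List.Relation.Unary.All using (All)
  open import Data.List.Relation.Unary.All.Properties using (++⁻ˡ; ++⁻ʳ)
  open import Data.List.Relation.Unary.AllPairs using (_∷_)
  open import Data.List.Relation.Unary.Unique.Propositional using (Unique)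
  open import Relation.Binary.PropositionalEquality using (_≡_; trans; cong; setoid)
  open ListSums using (len)

  module _ {A : Set} where

    Unique-resp-↭ : ∀ {xs ys : List A} → xs ↭ ys → Unique xs → Unique ys
    Unique-resp-↭ σ = Setoid.Unique-resp-↭ (setoid A) (↭⇒↭ₛ σ)

    Unique-++⁻ʳ : ∀ (xs : List A) {ys} → Unique (xs ++ ys) → Unique ys
    Unique-++⁻ʳ []       u       = u
    Unique-++⁻ʳ (_ ∷ xs) (_ ∷ u) = Unique-++⁻ʳ xs u

    Unique-↭ʳ : ∀ {xs : List A} ys {zs} → xs ↭ ys ++ zs → Unique xs → Unique zs
    Unique-↭ʳ ys σ u = Unique-++⁻ʳ ys (Unique-resp-↭ σ u)

    All-↭ˡ : ∀ {P : A → Set} {xs} ys {zs} → xs ↭ ys ++ zs → All P xs → All P ys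
    All-↭ˡ ys σ all = ++⁻ˡ ys (All-resp-↭ σ all)

    All-↭ʳ : ∀ {P : A → Set} {xs} ys {zs} → xs ↭ ys ++ zs → All P xs → All P zs
    All-↭ʳ ys σ all = ++⁻ʳ ys (All-resp-↭ σ all)

    len-split : ∀ {xs : List A} ys zs → xs ↭ ys ++ zs → len xs ≡ len ys + len zs
    len-split ys zs σ = cong +_ (trans (↭-length σ) (length-++ ys))

-- Greedy search for a cheap transitive tournament.

module CheapTile {n} (G : Digraph n) where

  open import Data.Bool using (Bool; false)
  open import Data.Empty using (⊥; ⊥-elim)
  open import Data.Fin using (Fin)
  open import Data.Integer using (ℤ; +_; 0ℤ; 1ℤ; _+_; _-_; _*_; -_; _≤_; +≤+)
  open import Data.Integer.Properties using (≤-trans; ≤-refl; ≤-reflexive)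
  open import Data.Integer.Tactic.RingSolver using (solve-∀)
  open import Data.List using (List; []; _∷_; _++_; length)
  open import Data.List.Properties using (length-++)
  open import Data.List.Relation.Binary.Permutation.Propositional using (_↭_; refl; prep) renaming (trans to _⟫_)
  open import Data.List.Relation.Binary.Permutation.Propositional.Properties using (All-resp-↭; shift; ++⁺ˡ; ++⁺ʳ; ++-comm; ++-assoc)
  open import Data.List.Relation.Unary.All as All using (All; []; _∷_)
  open import Data.List.Relation.Unary.AllPairs using (AllPairs; []; _∷_)
  import Data.List.Relation.Unary.AllPairs.Properties as AllPairs
  open import Data.List.Relation.Unary.Unique.Propositional using (Unique)
  open import Data.Nat as ℕ using (ℕ; zero; suc; z≤n)
  import Data.Nat.Properties as ℕ
  open import Data.Product using (_,_)
  open import Data.Sum as Sum using (_⊎_; inj₁; inj₂)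
  open import Relation.Binary.PropositionalEquality using (_≡_; _≢_; refl; sym; trans; cong; subst; subst₂)
  open ListSums
  open Permutations

  module _
    (M : Fin n → Fin n → Bool)
    (dominates : ∀ z → (∀ v → M z v ≡ false → Edge G z v) ⊎ (∀ v → M z v ≡ false → Edge G v z))
    (Small : Fin n → Set)
    (complete : ∀ {u v} → u ≢ v → Small u → Small v → Edge G u v)
    (c : Fin n → ℤ)
    (q : ℕ)
    where

    private
      Q = + q
      V = List (Fin n)

    -- In the second case, passing to the dominant neighbourhood of `u` discards at most `q`
    -- vertices of `U`, because `M u` marks the vertices outside it.
    Usable : V → Fin n → Set
    Usable U u = Small u ⊎ count (M u) U ≤ Q

    usable-++ʳ : ∀ {xs} ys {zs} → xs ↭ ys ++ zs → All (Usable xs) xs → All (Usable zs) zs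
    usable-++ʳ ys σ us = All.map (Sum.map₂ (≤-trans (count-++ʳ _ ys _ σ))) (All-↭ʳ ys σ us)

    -- `cheap` bounds the excess of the tile's cost over `k * a` by `1/q` times the total excess of
    -- `U` over `len U * a`, written without subtraction or division. If `len U` is close to
    -- `k * q`, the terms in `a` nearly cancel, and the tile costs at most about `k` times the
    -- average cost in `U`. The tile may draw on the pool `P`.
    record Tile (k : ℕ) (P U : V) (a : ℤ) : Set where
      constructor mkTile
      field
        tile rest  : V
        partition  : P ++ U ↭ tile ++ rest
        transitive : AllPairs (Edge G) tile
        size       : length tile ≡ k
        cheap      : Q * ∑ c tile + len U * a ≤ ∑ c U + + k * Q * a

    size-≥ : ∀ k Q j u → 0ℤ ≤ j → k * (Q + k) + j ≤ u → k * Q ≤ u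
    size-≥ k Q j u 0≤j h = eq k Q j u ⊢ 0≤+ (gap h) (0≤+ (0≤square k) 0≤j)
      where
      eq : ∀ k Q j u → u - k * Q ≡ (u - (k * (Q + k) + j)) + (k * k + j)
      eq = solve-∀

    -- Going from `b` down to `a` lowers the left side by `u * (b - a)` and the right side by only
    -- `KQ * (b - a)`. This carries a bound relative to the cost of the extracted vertex back to the
    -- original floor `a`.
    raise : ∀ X u s KQ {a b} → a ≤ b → KQ ≤ u → X + u * b ≤ s + KQ * b → X + u * a ≤ s + KQ * a
    raise X u s KQ {a} {b} a≤b KQ≤u h = eq X u s KQ a b ⊢ 0≤+ (gap h) (0≤* (gap KQ≤u) (gap a≤b))
      where
      eq : ∀ X u s KQ a b → (s + KQ * a) - (X + u * a) ≡ ((s + KQ * b) - (X + u * b)) + (u - KQ) * (b - a)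
      eq = solve-∀

    -- The cheapest remaining vertex is taken again and again. A non-small one is put into the tile, and the
    -- search goes on in its dominant neighbourhood; small ones are collected in the pool P, which is
    -- itself a tile as soon as it has k elements. All vertices that are still available cost at least a.
    cheap-tile : ∀ k j P U {a} → length P ℕ.+ j ≡ k →
      AllPairs (Edge G) P → ∑ c P ≤ len P * a →
      Unique U → All (λ u → Small u → All (Edge G u) P) U →
      All (Usable U) U → All (λ u → a ≤ c u) U →
      + k * (Q + + k) + + j ≤ len U →
      Tile k P U a
    cheap-tile k zero P U {a} |P|≡k edges cP≤ _ _ _ a≤c _ =
      -- The pool is the tile: it costs at most `len P * a`, while `U` costs at least `len U * a`.
      mkTile P U refl edges (trans (sym (ℕ.+-identityʳ _)) |P|≡k)
        (subst (λ k → Q * ∑ c P + len U * a ≤ ∑ c U + + k * Q * a) (trans (sym (ℕ.+-identityʳ _)) |P|≡k)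
          (eq Q (∑ c P) (len U) a (∑ c U) (len P) ⊢ 0≤+ (gap (∑-≥ a≤c)) (0≤* {Q} (+≤+ z≤n) (gap cP≤))))
      where
      eq : ∀ Q X u a s K → (s + K * Q * a) - (Q * X + u * a) ≡ (s - u * a) + Q * (K * a - X)
      eq = solve-∀
    -- The size hypothesis excludes an empty `U` while `j` is positive.
    cheap-tile k (suc j) P [] |P|+j≡k edges cP≤ uniq pool us a≤c large = ⊥-elim (absurd (≤-trans
      (eq (+ k) Q (+ suc j) ⊢ 0≤* {+ k} (+≤+ z≤n) (0≤+ {Q} (+≤+ z≤n) (+≤+ z≤n))) large))
      where
      eq : ∀ k Q j → (k * (Q + k) + j) - j ≡ k * (Q + k)
      eq = solve-∀
      absurd : + suc j ≤ 0ℤ → ⊥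
      absurd (+≤+ ())
    cheap-tile k (suc j) P (x ∷ xs) {a} |P|+j≡k edges cP≤ uniq pool us a≤c large
      with extract-min c x xs
    ... | v , U₀ , σ , mins with All-resp-↭ σ us | All-resp-↭ σ a≤c | Unique-resp-↭ σ uniq | All-resp-↭ σ pool
    -- A small `v` joins the pool, and its cost becomes the new floor. Small vertices chosen later
    -- are placed before `v`; completeness supplies their edges to it.
    ... | inj₁ small ∷ _ | a≤cv ∷ _ | v∉U₀ ∷ uniq₀ | pv ∷ pool₀ = mkTile T W
          (++⁺ˡ P σ ⟫ (shift v P U₀ ⟫ part)) trn sz
          (raise (Q * ∑ c T) (len (x ∷ xs)) (∑ c (x ∷ xs)) (+ k * Q) a≤cv
            (size-≥ (+ k) Q (+ suc j) (len (x ∷ xs)) (+≤+ z≤n) large)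
            (subst₂ (λ u s → Q * ∑ c T + u * c v ≤ s + + k * Q * c v)
              (sym (len-split (v ∷ []) U₀ σ)) (sym (∑-↭ c σ))
              (eq₂ (Q * ∑ c T) (len U₀) (c v) (∑ c U₀) (+ k * Q) ⊢ gap chp)))
      where
      eq₂ : ∀ X u a s K → ((a + s) + K * a) - (X + (1ℤ + u) * a) ≡ (s + K * a) - (X + u * a)
      eq₂ = solve-∀
      eq₃ : ∀ X p a b → ((1ℤ + p) * b) - (b + X) ≡ (p * a - X) + p * (b - a)
      eq₃ = solve-∀
      pred-≤ : ∀ k j u → k + (1ℤ + j) ≤ 1ℤ + u → k + j ≤ u
      pred-≤ k j u h = eq k j u ⊢ gap h
        where
        eq : ∀ k j u → u - (k + j) ≡ (1ℤ + u) - (k + (1ℤ + j))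
        eq = solve-∀
      IH = cheap-tile k j (v ∷ P) U₀ {c v} (trans (sym (ℕ.+-suc (length P) j)) |P|+j≡k)
             (pv small ∷ edges)
             -- Pool elements cost at most `a` on average, hence at most the new floor `c v`.
             (eq₃ (∑ c P) (len P) a (c v) ⊢ 0≤+ (gap cP≤) (0≤* (0≤len P) (gap a≤cv)))
             uniq₀
             (All.zipWith (λ (v≢u , p) s → complete (λ u≡v → v≢u (sym u≡v)) s small ∷ p s) (v∉U₀ , pool₀))
             (usable-++ʳ (v ∷ []) σ us)
             mins
             (pred-≤ (+ k * (Q + + k)) (+ j) (len U₀) (≤-trans large (≤-reflexive (len-split (v ∷ []) U₀ σ))))
      open Tile IH renaming (tile to T; rest to W; partition to part; transitive to trn; size to sz; cheap to chp)
    cheap-tile zero (suc j) P (x ∷ xs) |P|+j≡k edges cP≤ uniq pool us a≤c large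
      | v , U₀ , σ , mins | inj₂ _ ∷ _ | _ | _ | _
      with () ← trans (sym (ℕ.+-suc (length P) j)) |P|+j≡k
    -- If `v` misses few vertices, the search restarts with an empty pool inside `U₁`, the dominant
    -- neighbours of `v` in `U₀`, for a tile with one vertex fewer.
    cheap-tile (suc k) (suc j) P (x ∷ xs) {a} |P|+j≡k edges cP≤ uniq pool us a≤c large
      | v , U₀ , σ , mins | inj₂ few ∷ _ | a≤cv ∷ _ | v∉U₀ ∷ uniq₀ | _
      with split (M v) U₀
    ... | U₁ , U₂ , τ , near , _ , |U₂| = extend (dominates v)
      where
      σ₁ : x ∷ xs ↭ (v ∷ U₂) ++ U₁
      σ₁ = σ ⟫ prep v (τ ⟫ ++-comm U₁ U₂)
      |U| : len (x ∷ xs) ≡ 1ℤ + (len U₁ + len U₂)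
      |U| = trans (len-split (v ∷ []) U₀ σ) (cong (_+_ 1ℤ) (len-split U₁ U₂ τ))
      cU : ∑ c (x ∷ xs) ≡ c v + (∑ c U₁ + ∑ c U₂)
      cU = trans (∑-↭ c σ) (cong (_+_ (c v)) (∑-split c U₁ U₂ τ))
      |U₂|≤Q : len U₂ ≤ Q
      |U₂|≤Q = subst (_≤ Q) |U₂| (≤-trans (count-++ʳ (M v) (v ∷ []) U₀ σ) few)
      -- Lowering `k` by one frees `Q` for the discarded `U₂`; the square in the size hypothesis
      -- pays for resetting `j` to `K`, as the empty pool requires.
      shrink : ∀ K Q j u₁ u₂ → 0ℤ ≤ K → 0ℤ ≤ j → u₂ ≤ Q →
        (1ℤ + K) * (Q + (1ℤ + K)) + (1ℤ + j) ≤ 1ℤ + (u₁ + u₂) → K * (Q + K) + K ≤ u₁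
      shrink K Q j u₁ u₂ 0≤K 0≤j u₂≤Q h = eq K Q j u₁ u₂ ⊢
        0≤+ (gap h) (0≤+ (gap u₂≤Q) (0≤+ (0≤+ {1ℤ} (+≤+ z≤n) 0≤K) 0≤j))
        where
        eq : ∀ K Q j u₁ u₂ → u₁ - (K * (Q + K) + K) ≡
          ((1ℤ + (u₁ + u₂)) - ((1ℤ + K) * (Q + (1ℤ + K)) + (1ℤ + j))) + ((Q - u₂) + ((1ℤ + K) + j))
        eq = solve-∀
      IH : Tile k [] U₁ (c v)
      IH = cheap-tile k k [] U₁ refl [] ≤-refl
             (Unique-↭ʳ (v ∷ U₂) σ₁ uniq) (All.universal (λ _ _ → []) U₁)
             (usable-++ʳ (v ∷ U₂) σ₁ us) (All-↭ˡ U₁ τ mins)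
             (shrink (+ k) Q (+ j) (len U₁) (len U₂) (+≤+ z≤n) (+≤+ z≤n) |U₂|≤Q
               (≤-trans large (≤-reflexive |U|)))
      open Tile IH renaming (tile to T; rest to W; partition to part; transitive to trn; size to sz; cheap to chp)
      -- The old pool is given back, together with the discarded vertices.
      W′ = W ++ U₂ ++ P
      shape : P ++ x ∷ xs ↭ (v ∷ T) ++ W′
      shape = ++-comm P (x ∷ xs) ⟫ (++⁺ʳ P (σ ⟫ prep v (τ ⟫ ++⁺ʳ U₂ part)) ⟫ prep v
        (++-assoc (T ++ W) U₂ P ⟫ ++-assoc T W (U₂ ++ P)))
      eq₂ : ∀ K Q u₁ u₂ a s₁ s₂ X →
        ((a + (s₁ + s₂)) + (1ℤ + K) * Q * a) - (Q * (a + X) + (1ℤ + (u₁ + u₂)) * a) ≡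
        ((s₁ + K * Q * a) - (Q * X + u₁ * a)) + (s₂ - u₂ * a)
      eq₂ = solve-∀
      cost : Q * (c v + ∑ c T) + len (x ∷ xs) * a ≤ ∑ c (x ∷ xs) + + suc k * Q * a
      cost = raise (Q * (c v + ∑ c T)) (len (x ∷ xs)) (∑ c (x ∷ xs)) (+ suc k * Q) a≤cv
        (size-≥ (+ suc k) Q (+ suc j) (len (x ∷ xs)) (+≤+ z≤n) large)
        (subst₂ (λ u s → Q * (c v + ∑ c T) + u * c v ≤ s + + suc k * Q * c v) (sym |U|) (sym cU)
          (eq₂ (+ k) Q (len U₁) (len U₂) (c v) (∑ c U₁) (∑ c U₂) (∑ c T) ⊢
            0≤+ (gap chp) (gap (∑-≥ (All-↭ʳ U₁ τ mins)))))
      nearT : All (λ u → M v u ≡ false) T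
      nearT = All-↭ˡ T part near
      -- The smaller tile lies entirely in the out-neighbourhood or entirely in the in-neighbourhood
      -- of `v`, so `v` becomes its source or its sink.
      extend : _ → Tile (suc k) P (x ∷ xs) a
      extend (inj₁ out) = mkTile (v ∷ T) W′ shape (All.map (out _) nearT ∷ trn) (cong suc sz) cost
      extend (inj₂ in′) = mkTile (T ++ v ∷ []) W′
        (shape ⟫ ++⁺ʳ W′ (++-comm (v ∷ []) T))
        (AllPairs.++⁺ trn ([] ∷ []) (All.map (λ e → in′ _ e ∷ []) nearT))
        (trans (length-++ T) (trans (ℕ.+-comm _ 1) (cong suc sz)))
        (subst (λ t → Q * t + len (x ∷ xs) * a ≤ ∑ c (x ∷ xs) + + suc k * Q * a)
          (∑-↭ c (++-comm (v ∷ []) T)) cost)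

-- The quadratic potential and its change under deletion.

module Potentials where

  open import Data.Integer using (ℤ; -[1+_]; 0ℤ; _+_; _-_; _*_; -_; _≤_)
  open import Data.Integer.Properties using (≤-trans; ≤-reflexive)
  open import Data.Integer.Tactic.RingSolver using (solve-∀)
  open import Data.List using (List; _++_)
  open import Data.List.Relation.Binary.Permutation.Propositional using (_↭_)
  import Data.List.Relation.Unary.All as All
  open import Relation.Binary.PropositionalEquality using (_≡_; sym; trans; cong; cong₂; subst)
  open ListSums

  module Potential {A : Set} (f : A → A → ℤ) (Z : List A)
    (f≥ : ∀ z v → - len Z ≤ f z v) (f≤ : ∀ z v → f z v ≤ len Z) where

    private
      N = len Z

    e : A → List A → ℤ
    e z = ∑ (f z)

    Φ : List A → ℤ
    Φ R = ∑ (λ z → e z R * e z R) Z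

    0≤Φ : ∀ R → 0ℤ ≤ Φ R
    0≤Φ R = ∑-nonNeg (λ z → 0≤square (e z R)) Z

    -- To first order, deleting v from R changes Φ by cost R v.
    cost : List A → A → ℤ
    cost R v = ∑ (λ z → -[1+ 1 ] * e z R * f z v) Z

    ∑-cost : ∀ R T → ∑ (cost R) T ≡ ∑ (λ z → -[1+ 1 ] * e z R * e z T) Z
    ∑-cost R T = trans (∑-swap (λ v z → -[1+ 1 ] * e z R * f z v) T Z)
      (∑-cong (λ z → ∑-*ˡ (-[1+ 1 ] * e z R) (f z) T) Z)

    -- Here `-[1+ 1 ]` is the integer -2. The average cost over `R` is therefore never positive,
    -- which makes a tile of about `r` times the average cost harmless.
    ∑-cost-self : ∀ R → ∑ (cost R) R ≡ -[1+ 1 ] * Φ R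
    ∑-cost-self R = trans (∑-cost R R)
      (trans (∑-cong (λ z → eq -[1+ 1 ] (e z R)) Z) (∑-*ˡ -[1+ 1 ] (λ z → e z R * e z R) Z))
      where
      eq : ∀ a b → a * b * b ≡ a * (b * b)
      eq = solve-∀

    -- Expand the nonnegative square of `e z R - D * f z v`, bound the square of `f z v` by `N * N`,
    -- and sum over `z`. The result serves as the floor in the search for a tile and also limits how
    -- negative the cost of exceptional vertices can be.
    cost-≥ : ∀ R D v → - (Φ R + D * D * (N * N * N)) ≤ D * cost R v
    cost-≥ R D v = drop (D * cost R v) (Φ R) (D * D * (N * N * N)) (≤-trans bound (≤-reflexive total))
      where
      drop : ∀ c p d → 0ℤ ≤ (c + p) + d → - (p + d) ≤ c
      drop c p d h = eq c p d ⊢ h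
        where
        eq : ∀ c p d → c - - (p + d) ≡ (c + p) + d
        eq = solve-∀
      term : A → ℤ
      term z = (D * (-[1+ 1 ] * e z R * f z v) + e z R * e z R) + D * D * (N * N)
      0≤term : ∀ z → 0ℤ ≤ term z
      0≤term z = ≤-trans
        (0≤+ (0≤square (e z R - D * f z v)) (0≤* (0≤square D) (gap (square-≤ (f≥ z v) (f≤ z v)))))
        (≤-reflexive (eq (e z R) D (f z v) N))
        where
        eq : ∀ e D f N → (e - D * f) * (e - D * f) + D * D * (N * N - f * f) ≡
          (D * (-[1+ 1 ] * e * f) + e * e) + D * D * (N * N)
        eq = solve-∀
      bound : 0ℤ ≤ ∑ term Z
      bound = ∑-nonNeg 0≤term Z
      total : ∑ term Z ≡ (D * cost R v + Φ R) + D * D * (N * N * N)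
      total = trans (∑-+ _ _ Z) (trans
        (cong₂ _+_ (trans (∑-+ _ _ Z) (cong (λ x → x + Φ R) (∑-*ˡ D _ Z))) (∑-const _ Z))
        (cong (_+_ (D * cost R v + Φ R)) (eq D N)))
        where
        eq : ∀ D N → N * (D * D * (N * N)) ≡ D * D * (N * N * N)
        eq = solve-∀

    -- For each `z`, `e z W` is `e z R - e z T`. Its square splits into the old term, the
    -- contribution to the cost of `T`, and the square of `e z T`, where `e z T` is at most
    -- `len T * N` in absolute value.
    Φ-step : ∀ {R} T W → R ↭ T ++ W → Φ W ≤ Φ R + ∑ (cost R) T + len T * len T * (N * N * N)
    Φ-step {R} T W σ = ≤-trans (∑-mono (All.universal pointwise Z)) (≤-reflexive total)
      where
      L = len T
      bound : A → ℤ
      bound z = (e z R * e z R + -[1+ 1 ] * e z R * e z T) + L * N * (L * N)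
      pointwise : ∀ z → e z W * e z W ≤ bound z
      pointwise z = subst (λ x → e z W * e z W ≤ (x * x + -[1+ 1 ] * x * e z T) + L * N * (L * N))
        (sym (∑-split (f z) T W σ))
        (eq (e z T) (e z W) (L * N) ⊢ gap (square-≤ {e z T} {L * N}
          (≤-trans (≤-reflexive (neg L N)) (∑-≥ (All.universal (f≥ z) T)))
          (∑-≤ (All.universal (f≤ z) T))))
        where
        neg : ∀ L N → - (L * N) ≡ L * - N
        neg = solve-∀
        eq : ∀ t w x → (((t + w) * (t + w) + -[1+ 1 ] * (t + w) * t) + x * x) - w * w ≡ x * x - t * t
        eq = solve-∀
      total : ∑ bound Z ≡ Φ R + ∑ (cost R) T + L * L * (N * N * N)
      total = trans (∑-+ _ _ Z) (cong₂ _+_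
        (trans (∑-+ _ _ Z) (cong (_+_ (Φ R)) (sym (∑-cost R T))))
        (trans (∑-const _ Z) (eq L N)))
        where
        eq : ∀ L N → N * (L * N * (L * N)) ≡ L * L * (N * N * N)
        eq = solve-∀

-- Removing one tile at a bounded increase of the potential.

module Removal where

  open import Data.Bool using (Bool; true; false; not; _∧_)
  open import Data.Fin using (Fin)
  open import Data.Integer using (ℤ; +_; -[1+_]; 0ℤ; 1ℤ; _+_; _-_; _*_; -_; _≤_; _≤?_; +≤+)
  open import Data.Integer.Properties
  open import Data.Integer.Tactic.RingSolver using (solve-∀)
  open import Data.List using (List; []; _++_; length; allFin)
  open import Data.List.Relation.Binary.Permutation.Propositional using (_↭_; refl; ↭-trans)
  open import Data.List.Relation.Binary.Permutation.Propositional.Properties using (++⁺ʳ; ++-assoc; ++-comm)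
  open import Data.List.Relation.Unary.All as All using (All; [])
  open import Data.List.Relation.Unary.AllPairs using (AllPairs; [])
  open import Data.List.Relation.Unary.Unique.Propositional using (Unique)
  open import Data.Nat as ℕ using (ℕ; z≤n)
  import Data.Nat.Properties as ℕ
  open import Data.Product using (_,_)
  open import Data.Sum as Sum using (_⊎_; inj₁; inj₂)
  open import Relation.Binary.PropositionalEquality using (_≡_; _≢_; refl; sym; trans; cong; cong₂; subst)
  open import Relation.Nullary using (¬_; Dec; yes; no; does)
  open ListSums
  open Permutations

  module Constants (r g : ℕ) where

    private
      ρ = + r
      γ = + g

    -- Each step raises Φ by at most K n³. At most C non-small vertices are exceptional, i.e. miss too
    -- many of the remaining vertices, and D bounds the slack in the choice of q in each step.
    K C D : ℤ
    K = ρ * ρ + 1ℤ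
    C = ρ * γ * γ * (ρ * γ * γ) * K
    D = C + ρ * ρ + ρ + ρ

    0≤K : 0ℤ ≤ K
    0≤K = 0≤+ (0≤square ρ) (+≤+ z≤n)

    0≤C : 0ℤ ≤ C
    0≤C = 0≤* (0≤square (ρ * γ * γ)) 0≤K

    1≤D : 1 ℕ.≤ r → 1ℤ ≤ D
    1≤D 1≤r = ≤-trans (+≤+ 1≤r)
      (eq C ρ ⊢ 0≤+ (0≤+ 0≤C (0≤square ρ)) (+≤+ z≤n))
      where
      eq : ∀ C ρ → (C + ρ * ρ + ρ + ρ) - ρ ≡ (C + ρ * ρ) + ρ
      eq = solve-∀

  module Graph
    {n} (G : Digraph n)
    (M : Fin n → Fin n → Bool)
    (dominates : ∀ z → (∀ v → M z v ≡ false → Edge G z v) ⊎ (∀ v → M z v ≡ false → Edge G v z))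
    (Small : Fin n → Set)
    (small? : ∀ z → Dec (Small z))
    (complete : ∀ {u v} → u ≢ v → Small u → Small v → Edge G u v)
    where

    V : List (Fin n)
    V = allFin n

    N : ℤ
    N = len V

    missed : Fin n → List (Fin n) → ℤ
    missed z = count (M z)

    -- The indicator of `M z`, scaled by `N` and centred to have sum 0 over `V`. Its sum over `R`
    -- measures how far the share of `M z` in `R` departs from that in `V`.
    f : Fin n → Fin n → ℤ
    f z v = N * [ M z v ] - missed z V

    f≥ : ∀ z v → - N ≤ f z v
    f≥ z v = eq N [ M z v ] (missed z V) ⊢ 0≤+ (0≤* (0≤len V) 0≤[ M z v ]) (gap (count≤len (M z) V))
      where
      eq : ∀ N b m → (N * b - m) - - N ≡ N * b + (N - m)
      eq = solve-∀

    f≤ : ∀ z v → f z v ≤ N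
    f≤ z v = eq N [ M z v ] (missed z V) ⊢ 0≤+ (0≤* (0≤len V) (gap [ M z v ]≤1)) (0≤count (M z) V)
      where
      eq : ∀ N b m → N - (N * b - m) ≡ N * (1ℤ - b) + m
      eq = solve-∀

    open Potentials.Potential f V f≥ f≤ public

    e-missed : ∀ z R → e z R ≡ N * missed z R - len R * missed z V
    e-missed z R = trans (∑-+ _ _ R)
      (trans (cong₂ _+_ (∑-*ˡ N _ R) (∑-const _ R)) (eq (N * missed z R) (len R) (missed z V)))
      where
      eq : ∀ a l m → a + l * - m ≡ a - l * m
      eq = solve-∀

    Φ-V : Φ V ≡ 0ℤ
    Φ-V = trans (∑-cong (λ z → cong₂ _*_ (eV z) (eV z)) V) (trans (∑-const 0ℤ V) (*-zeroʳ N))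
      where
      eV : ∀ z → e z V ≡ 0ℤ
      eV z = trans (e-missed z V) (+-inverseʳ (N * missed z V))

    -- Divided by `r * g`, the hypothesis `few-missed` says that a non-small `z` misses at most
    -- `N/r - N/g` vertices.
    module Slack (r g : ℕ)
      (few-missed : ∀ z → ¬ Small z → + r * + g * missed z V + + r * N ≤ + g * N)
      where

      private
        ρ = + r
        γ = + g
        N³ = N * N * N

      open Constants r g public

      record Step (R : List (Fin n)) : Set where
        constructor mkStep
        field
          tile rest  : List (Fin n)
          partition  : R ↭ tile ++ rest
          transitive : AllPairs (Edge G) tile
          size       : length tile ≡ r
          Φ-rest     : Φ rest ≤ Φ R + K * N³

      -- As `m ≥ q`, the density of `M z` in `R` is at least about `1/r`, against at most
      -- `1/r - 1/g` in `V`, so `e` is at least about `N * L / g`. The slack `D` costs at most the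
      -- share `1/r` of this, because `γ * D ≤ L`. With `ρ ≥ 2` and `N ≤ γ * L`, what is left is at
      -- least `N * N` divided by `r * g * g`.
      deviation : ∀ L D q m μ e → 0ℤ ≤ L → 0ℤ ≤ γ → 0ℤ ≤ ρ → 1ℤ + 1ℤ ≤ ρ → 0ℤ ≤ N →
        N ≤ γ * L → γ * D ≤ L → L ≤ ρ * q + D → q ≤ m →
        ρ * γ * μ + ρ * N ≤ γ * N → e ≡ N * m - L * μ → N * N ≤ ρ * γ * γ * e
      deviation L D q m μ e 0≤L 0≤γ 0≤ρ 2≤ρ 0≤N N≤γL γD≤L L≤ q≤m few e≡ = eq L D q m μ e e≡ ⊢
        0≤+ (0≤* 0≤N (gap N≤γL)) (0≤* 0≤γ (0≤+ (0≤* 0≤L (gap few))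
          (0≤* 0≤N (0≤+ (0≤* 0≤γ (0≤+ (gap L≤) (0≤* 0≤ρ (gap q≤m)))) (0≤+ (gap γD≤L) (0≤* (gap 2≤ρ) 0≤L))))))
        where
        eq′ : ∀ N ρ γ L D q m μ → ρ * γ * γ * (N * m - L * μ) - N * N ≡
          N * (γ * L - N) + γ * (L * (γ * N - (ρ * γ * μ + ρ * N)) +
            N * (γ * ((ρ * q + D - L) + ρ * (m - q)) + ((L - γ * D) + (ρ - (1ℤ + 1ℤ)) * L)))
        eq′ = solve-∀
        eq : ∀ L D q m μ e → e ≡ N * m - L * μ → ρ * γ * γ * e - N * N ≡
          N * (γ * L - N) + γ * (L * (γ * N - (ρ * γ * μ + ρ * N)) +
            N * (γ * ((ρ * q + D - L) + ρ * (m - q)) + ((L - γ * D) + (ρ - (1ℤ + 1ℤ)) * L)))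
        eq L D q m μ e refl = eq′ N ρ γ L D q m μ

      module _ (q : ℕ) (A R : List (Fin n))
        (V↭ : V ↭ A ++ R) (uniq : Unique V) (2≤r : 2 ℕ.≤ r) (1≤N : 1ℤ ≤ N)
        (Φ≤ : Φ R ≤ K * (N * N * (N * N)))
        (N≤γR : N ≤ γ * len R) (γD≤R : γ * D ≤ len R) (R≤ : len R ≤ ρ * + q + D)
        (≤R : ρ * + q + (C + ρ * ρ + ρ) ≤ len R) (1≤q : 1ℤ ≤ + q) (DD≤q : D * D ≤ + q)
        where

        private
          Q = + q

          exceptional : Fin n → Bool
          exceptional z = not (does (small? z)) ∧ not (does (missed z R ≤? Q))

          unexceptional-usable : ∀ z → exceptional z ≡ false → Small z ⊎ missed z R ≤ Q
          unexceptional-usable z ¬ex with small? z | missed z R ≤? Q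
          ... | yes s | _      = inj₁ s
          ... | no _  | yes ≤q = inj₂ ≤q
          unexceptional-usable z () | no _ | no _

          exceptional-deviates : ∀ z → exceptional z ≡ true → N * N ≤ ρ * γ * γ * e z R
          exceptional-deviates z ex with small? z | missed z R ≤? Q
          exceptional-deviates z () | yes _ | _
          exceptional-deviates z () | no _  | yes _
          ... | no ¬s | no ¬≤q = deviation (len R) D Q (missed z R) (missed z V) (e z R)
            (+≤+ z≤n) (+≤+ z≤n) (+≤+ z≤n) (+≤+ 2≤r) (+≤+ z≤n) N≤γR γD≤R R≤
            (<⇒≤ (≰⇒> ¬≤q)) (few-missed z ¬s) (e-missed z R)

          -- Each exceptional `z` contributes at least N⁴/w² to Φ(R), which is at most K N⁴. Hence
          -- there are at most w² K of them, and this number is `C`.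
          few-exceptional : ∀ U X → R ↭ U ++ X → All (λ z → exceptional z ≡ true) X → len X ≤ C
          few-exceptional U X σ ex = cancel-*ˡ-≤ (N * N * (N * N)) (1≤* (1≤* 1≤N 1≤N) (1≤* 1≤N 1≤N)) (begin
            N * N * (N * N) * len X                        ≡⟨ *-comm (N * N * (N * N)) (len X) ⟩
            len X * (N * N * (N * N))                      ≤⟨ ∑-≥ (All.map (λ {z} → large-square z) ex) ⟩
            ∑ (λ z → w * w * (e z R * e z R)) X            ≡⟨ ∑-*ˡ (w * w) _ X ⟩
            w * w * ∑ (λ z → e z R * e z R) X              ≤⟨ scale (≤-trans
                                                                (∑-++ʳ (λ z → 0≤square (e z R)) U X σ)
                                                                (∑-++ʳ (λ z → 0≤square (e z R)) A R V↭)) ⟩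
            w * w * Φ R                                    ≤⟨ scale Φ≤ ⟩
            w * w * (K * (N * N * (N * N)))                ≡⟨ eq w K (N * N * (N * N)) ⟩
            N * N * (N * N) * C                            ∎)
            where
            open ≤-Reasoning
            w = ρ * γ * γ
            scale : ∀ {i j} → i ≤ j → w * w * i ≤ w * w * j
            scale {i} {j} i≤j = eq (w * w) i j ⊢ 0≤* (0≤square w) (gap i≤j)
              where
              eq : ∀ w i j → w * j - w * i ≡ w * (j - i)
              eq = solve-∀
            eq : ∀ w K x → w * w * (K * x) ≡ x * (w * w * K)
            eq = solve-∀
            large-square : ∀ z → exceptional z ≡ true → N * N * (N * N) ≤ w * w * (e z R * e z R)
            large-square z ex = ≤-trans
              (square-≤ (≤-trans (neg-mono-≤ 0≤we) (0≤square N)) (exceptional-deviates z ex))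
              (≤-reflexive (square-* w (e z R)))
              where
              0≤we : 0ℤ ≤ w * e z R
              0≤we = ≤-trans (0≤square N) (exceptional-deviates z ex)
              square-* : ∀ w e → w * e * (w * e) ≡ w * w * (e * e)
              square-* = solve-∀

          -- The exceptional vertices cost at least `x * a`, so the rest costs at most
          -- `-2DF - x * a`. Since `u + x` exceeds `ρ * Q` by at most `D`, this gives `QDc` at most
          -- -2DF + D(F + D²N³). Scaling the costs by `D` lets the floor use up only DF of the gain
          -- 2DF; the term in N³ is absorbed by `D * D ≤ q`.
          tile-cost : ∀ u x a sU sX c F → u + x ≤ ρ * Q + D → 0ℤ ≤ F → 0ℤ ≤ N³ → 1ℤ ≤ D →
            a ≡ - (F + D * D * N³) → sU + sX ≡ D * (-[1+ 1 ] * F) → x * a ≤ sX →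
            Q * (D * c) + u * a ≤ sU + ρ * Q * a → c ≤ N³
          tile-cost u x a sU sX c F L≤ 0≤F 0≤N³ 1≤D a≡ s≡ X≥ h =
            cancel-*ˡ-≤ (Q * D) (1≤* 1≤q 1≤D)
              (eq u x a sU sX c F a≡ (trans (sym (+-minus sU sX)) (cong (_- sX) s≡)) ⊢
                0≤+ (gap h) (0≤+ (gap X≥) (0≤+ (0≤* (gap L≤) (0≤+ 0≤F (0≤* (0≤square D) 0≤N³)))
                  (0≤+ (0≤* 0≤D 0≤F) (0≤* (0≤* (gap DD≤q) 0≤D) 0≤N³)))))
            where
            0≤D = ≤-trans (+≤+ z≤n) 1≤D
            +-minus : ∀ i j → (i + j) - j ≡ i
            +-minus = solve-∀
            eq′ : ∀ Q D ρ n u x sX c F → Q * D * n - Q * D * c ≡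
              (((D * (-[1+ 1 ] * F) - sX) + ρ * Q * - (F + D * D * n)) - (Q * (D * c) + u * - (F + D * D * n)))
              + ((sX - x * - (F + D * D * n))
              + ((ρ * Q + D - (u + x)) * (F + D * D * n) + (D * F + (Q - D * D) * D * n)))
            eq′ = solve-∀
            eq : ∀ u x a sU sX c F → a ≡ - (F + D * D * N³) → sU ≡ D * (-[1+ 1 ] * F) - sX →
              Q * D * N³ - Q * D * c ≡
              ((sU + ρ * Q * a) - (Q * (D * c) + u * a))
              + ((sX - x * a) + ((ρ * Q + D - (u + x)) * (F + D * D * N³) + (D * F + (Q - D * D) * D * N³)))
            eq u x a sU sX c F refl refl = eq′ Q D ρ N³ u x sX c F

        step : Step R
        step with split exceptional R
        -- The exceptional vertices `X` are kept out of the search only; they stay among the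
        -- remaining vertices.
        ... | U , X , σ , fs , ts , _ = mkStep T (W ++ X) shape trn sz total
          where
          c : Fin n → ℤ
          c v = D * cost R v
          a = - (Φ R + D * D * N³)
          |R| : len R ≡ len U + len X
          |R| = len-split U X σ
          σ′ : R ↭ X ++ U
          σ′ = ↭-trans σ (++-comm U X)
          -- Without the at most `C` exceptional vertices, `U` still has the size required by a
          -- search with empty pool and `k = j = r`.
          room : ∀ u x L → x ≤ C → L ≡ u + x → ρ * Q + (C + ρ * ρ + ρ) ≤ L → ρ * (Q + ρ) + ρ ≤ u
          room u x L x≤C refl h = eq ρ Q C u x ⊢ 0≤+ (gap h) (gap x≤C)
            where
            eq : ∀ ρ Q C u x → u - (ρ * (Q + ρ) + ρ) ≡ ((u + x) - (ρ * Q + (C + ρ * ρ + ρ))) + (C - x)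
            eq = solve-∀
          found = CheapTile.cheap-tile G M dominates Small complete c q r r [] U refl [] ≤-refl
            (Unique-↭ʳ X σ′ (Unique-↭ʳ A V↭ uniq))
            (All.universal (λ _ _ → []) U)
            (All.map (λ {z} ¬ex → Sum.map₂ (≤-trans (count-++ʳ (M z) X U σ′)) (unexceptional-usable z ¬ex)) fs)
            (All.universal (cost-≥ R D) U)
            (room (len U) (len X) (len R) (few-exceptional U X σ ts) |R| ≤R)
          open CheapTile.Tile found renaming (tile to T; rest to W; partition to part; transitive to trn; size to sz; cheap to chp)
          shape : R ↭ T ++ (W ++ X)
          shape = ↭-trans σ (↭-trans (++⁺ʳ X part) (++-assoc T W X))
          cT : ∑ (cost R) T ≤ N³
          cT = tile-cost (len U) (len X) a (∑ c U) (∑ c X) (∑ (cost R) T) (Φ R)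
            (subst (_≤ ρ * Q + D) |R| R≤) (0≤Φ R) (0≤* (0≤square N) (0≤len V)) (1≤D (ℕ.<⇒≤ 2≤r)) refl
            (trans (sym (∑-split c U X σ)) (trans (∑-*ˡ D (cost R) R) (cong (D *_) (∑-cost-self R))))
            (∑-≥ (All.universal (cost-≥ R D) X))
            (subst (λ t → Q * t + len U * a ≤ ∑ c U + ρ * Q * a) (∑-*ˡ D (cost R) T) chp)
          total : Φ (W ++ X) ≤ Φ R + K * N³
          total = ≤-trans (Φ-step T (W ++ X) shape) (bound (Φ R) (∑ (cost R) T) (len T) (cong +_ sz) cT)
            where
            bound : ∀ F c l → l ≡ ρ → c ≤ N³ → F + c + l * l * N³ ≤ F + K * N³
            bound F c l refl h = eq F c ρ N³ ⊢ gap h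
              where
              eq : ∀ F c l n → (F + (l * l + 1ℤ) * n) - (F + c + l * l * n) ≡ n - c
              eq = solve-∀

-- Adding a tile to a tiling.

module Tilings where

  open import Data.Empty using (⊥-elim)
  open import Data.Fin as Fin using (Fin; zero; suc)
  open import Data.Fin.Properties using (<-cmp)
  open import Data.List using (List; _∷_; _++_; length; lookup)
  open import Data.List.Membership.Propositional using (_∈_; _∉_)
  open import Data.List.Membership.Propositional.Properties using (∈-lookup; ∈-++⁺ˡ; ∈-++⁺ʳ)
  open import Data.List.Relation.Unary.All as All using (All; _∷_)
  open import Data.List.Relation.Unary.All.Properties using (++⁻ʳ)
  open import Data.List.Relation.Unary.AllPairs using (AllPairs; _∷_)
  open import Data.List.Relation.Unary.Any using (here; there)
  open import Data.List.Relation.Unary.Unique.Propositional using (Unique)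
  open import Data.Nat using (suc; s≤s)
  open import Data.Product using (Σ; _×_; _,_)
  open import Function using (_∘_)
  open import Relation.Binary using (tri<; tri≈; tri>)
  open import Relation.Binary.PropositionalEquality using (_≡_; refl; sym; trans; cong; subst)

  AllPairs-lookup : ∀ {A : Set} {R : A → A → Set} {xs} → AllPairs R xs →
    ∀ i j → i Fin.< j → R (lookup xs i) (lookup xs j)
  AllPairs-lookup {xs = _ ∷ xs} (r ∷ _)  zero    (suc j) _         = All.lookup r (∈-lookup j)
  AllPairs-lookup {xs = _ ∷ xs} (_ ∷ rs) (suc i) (suc j) (s≤s i<j) = AllPairs-lookup rs i j i<j

  Unique-disjoint : ∀ {A : Set} {x : A} xs {ys} → Unique (xs ++ ys) → x ∈ xs → x ∉ ys
  Unique-disjoint (_ ∷ xs) (x≢ ∷ _) (here refl) x∈ys = All.lookup (++⁻ʳ xs x≢) x∈ys refl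
  Unique-disjoint (_ ∷ xs) (_ ∷ u)  (there x∈)  x∈ys = Unique-disjoint xs u x∈ x∈ys

  module _ {n} {G : Digraph n} where

    open Tiling

    ∅ : ∀ {r} → Tiling G r 0
    ∅ .emb (() , _)
    ∅ .injective {() , _}
    ∅ .edges ()

    no-loop : ∀ {x y} → Edge G x y → x ≡ y → ∀ {A : Set} → A
    no-loop {x} e refl with () ← trans (sym e) (loopless G x)

    module _ {k} (T : List (Fin n)) (τ : Tiling G (length T) k)
      (transitive : AllPairs (Edge G) T) (new : ∀ p → emb τ p ∉ T) where

      emb′ : Fin (suc k) × Fin (length T) → Fin n
      emb′ (zero  , i) = lookup T i
      emb′ (suc t , i) = emb τ (t , i)

      -- Two different positions in the new tile are joined by an edge, so a common value would be a
      -- loop. The old tiles avoid `T`.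
      injective′ : ∀ {p q} → emb′ p ≡ emb′ q → p ≡ q
      injective′ {zero , i} {zero , j} eq with <-cmp i j
      ... | tri< i<j _ _ = no-loop (AllPairs-lookup transitive i j i<j) eq
      ... | tri≈ _ i≡j _ = cong (zero ,_) i≡j
      ... | tri> _ _ j<i = no-loop (AllPairs-lookup transitive j i j<i) (sym eq)
      injective′ {zero , i}  {suc t , j} eq = ⊥-elim (new (t , j) (subst (_∈ T) eq (∈-lookup i)))
      injective′ {suc t , i} {zero , j}  eq = ⊥-elim (new (t , i) (subst (_∈ T) (sym eq) (∈-lookup j)))
      injective′ {suc t , i} {suc s , j} eq with refl ← injective τ eq = refl

      added : Tiling G (length T) (suc k)
      added .emb           = emb′
      added .injective     = injective′
      added .edges zero    = AllPairs-lookup transitive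
      added .edges (suc t) = edges τ t

      added-∉ : ∀ W → (∀ p → emb τ p ∉ W) → (∀ {x} → x ∈ T → x ∉ W) → ∀ p → emb added p ∉ W
      added-∉ W old new′ (zero  , i) = new′ (∈-lookup i)
      added-∉ W old new′ (suc t , i) = old (t , i)

    add-tile : ∀ {r k} T W (τ : Tiling G r k) → AllPairs (Edge G) T → length T ≡ r →
      (∀ p → emb τ p ∉ T ++ W) → (∀ {x} → x ∈ T → x ∉ W) →
      Σ (Tiling G r (suc k)) λ τ′ → ∀ p → emb τ′ p ∉ W
    add-tile T W τ transitive refl old new =
      added T τ transitive old-∉T ,
      added-∉ T τ transitive old-∉T W (λ p → old p ∘ ∈-++⁺ʳ T) new
      where
      old-∉T : ∀ p → emb τ p ∉ T
      old-∉T p = old p ∘ ∈-++⁺ˡ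

-- Iterated removal of tiles.

module GreedyTiling where

  open import Data.Bool using (Bool; false)
  open import Data.Empty using (⊥-elim)
  open import Data.Fin using (Fin)
  open import Data.Integer as ℤ using (ℤ; +_; 0ℤ; 1ℤ; _+_; _-_; _*_; _≤_; +≤+; ∣_∣)
  open import Data.Integer.Properties as ℤ using (≤-trans; ≤-reflexive; drop‿+≤+; 0≤i⇒+∣i∣≡i; pos-*)
  open import Data.Integer.Tactic.RingSolver using (solve-∀)
  open import Data.List using (List; []; _++_; length)
  open import Data.List.Membership.Propositional using (_∉_)
  open import Data.List.Properties using (length-++; length-tabulate)
  open import Data.List.Relation.Binary.Permutation.Propositional using (_↭_; refl; ↭-trans; ↭-sym)
  open import Data.List.Relation.Binary.Permutation.Propositional.Properties using (++⁺ˡ; ++-assoc; ↭-length; ∈-resp-↭)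
  open import Data.List.Relation.Unary.Unique.Propositional using (Unique)
  open import Data.List.Relation.Unary.Unique.Propositional.Properties using (allFin⁺)
  open import Data.Nat as ℕ using (ℕ; zero; suc; z≤n; s≤s; NonZero)
  open import Data.Nat.DivMod using (_/_; _%_; m≡m%n+[m/n]*n; m%n<n)
  import Data.Nat.Properties as ℕ
  open import Data.Product using (Σ; _×_; _,_; proj₁; proj₂)
  open import Data.Sum using (_⊎_)
  open import Function using (id; _∘_)
  open import Relation.Binary.PropositionalEquality using (_≡_; _≢_; refl; sym; trans; cong; subst)
  open import Relation.Nullary using (¬_; Dec; yes; no)
  open ListSums
  open Permutations
  open Tilings
  open Removal
  open Tiling

  -- While more than `n/g` vertices remain, this size of `n` gives `len R` at least gD + D + rD².
  -- The first summand serves the deviation bound, the other two yield `D * D ≤ q`. The `suc` makes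
  -- `n` positive.
  threshold : ℕ → ℕ → ℕ
  threshold r g = suc ∣ + g * (+ g * D + D + + r * (D * D)) ∣
    where open Constants r g

  module _
    {n} (G : Digraph n)
    (M : Fin n → Fin n → Bool)
    (dominates : ∀ z → (∀ v → M z v ≡ false → Edge G z v) ⊎ (∀ v → M z v ≡ false → Edge G v z))
    (Small : Fin n → Set)
    (small? : ∀ z → Dec (Small z))
    (complete : ∀ {u v} → u ≢ v → Small u → Small v → Edge G u v)
    where

    open Removal.Graph G M dominates Small small? complete

    module _
      (r g : ℕ) (2≤r : 2 ℕ.≤ r) (1≤g : 1 ℕ.≤ g) (large : threshold r g ℕ.≤ n)
      (few-missed : ∀ z → ¬ Small z → + r * + g * missed z V + + r * N ≤ + g * N)
      where

      open Slack r g few-missed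

      private
        ρ = + r
        γ = + g

        1≤r : 1 ℕ.≤ r
        1≤r = ℕ.<⇒≤ 2≤r

        |V| : length V ≡ n
        |V| = length-tabulate id

        uniq : Unique V
        uniq = allFin⁺ n

        0≤D : 0ℤ ≤ D
        0≤D = ≤-trans (+≤+ z≤n) (1≤D 1≤r)

        C₁ = C + ρ * ρ + ρ

        0≤C₁ : 0ℤ ≤ C₁
        0≤C₁ = 0≤+ (0≤+ 0≤C (0≤square ρ)) (+≤+ z≤n)

      -- `count-≡` identifies the length of `R` with the number of vertices that the `k` tiles leave
      -- uncovered; `potential` adds up the increases of `k` steps.
      record State (k : ℕ) (R : List (Fin n)) : Set where
        field
          tiling    : Tiling G r k
          covered   : List (Fin n)
          partition : V ↭ covered ++ R
          avoids    : ∀ p → emb tiling p ∉ R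
          count-≡   : length R ℕ.+ k ℕ.* r ≡ n
          potential : Φ R ≤ + k * (K * (N * N * N))

      Progress : ℕ → List (Fin n) → Set
      Progress k R = Σ (List (Fin n)) λ W → length W ℕ.< length R × State (suc k) W

      initial : State 0 V
      initial = record
        { tiling = ∅ ; covered = [] ; partition = refl ; avoids = λ { (() , _) }
        ; count-≡ = trans (ℕ.+-identityʳ _) |V|
        ; potential = ≤-reflexive (trans Φ-V (sym (ℤ.*-zeroˡ (K * (N * N * N))))) }

      module _ {k R} (st : State k R) (unfinished : n ℕ.< g ℕ.* length R) where
        open State st

        private
          L = len R

          L-large : γ * D + D + ρ * (D * D) ≤ L
          L-large = cancel-*ˡ-≤ γ (+≤+ 1≤g) (≤-trans
            (≤-reflexive (sym (0≤i⇒+∣i∣≡i 0≤T)))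
            (≤-trans (+≤+ (ℕ.≤-trans (ℕ.n≤1+n _) (ℕ.≤-trans large (ℕ.<⇒≤ unfinished)))) (≤-reflexive (pos-* g (length R)))))
            where
            0≤T : 0ℤ ≤ γ * (γ * D + D + ρ * (D * D))
            0≤T = 0≤* {γ} (+≤+ z≤n) (0≤+ (0≤+ (0≤* {γ} (+≤+ z≤n) 0≤D) 0≤D) (0≤* {ρ} (+≤+ z≤n) (0≤square D)))

          c₁ = ∣ C₁ ∣
          +c₁ : + c₁ ≡ C₁
          +c₁ = 0≤i⇒+∣i∣≡i 0≤C₁

          instance
            r≢0 : NonZero r
            r≢0 = ℕ.>-nonZero 1≤r

          -- Rounding down gives `r * q + C₁ ≤ len R ≤ r * q + C₁ + r`, and `C₁ + r` is `D`. Within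
          -- `C₁`, the summand `C` is reserved for exceptional vertices and r² + r for the search.
          s = length R ℕ.∸ c₁
          q = s / r

          γD≤L : γ * D ≤ L
          γD≤L = ≤-trans (eq (γ * D) D (ρ * (D * D)) ⊢ 0≤+ 0≤D (0≤* {ρ} (+≤+ z≤n) (0≤square D))) L-large
            where
            eq : ∀ a b c → (a + b + c) - a ≡ b + c
            eq = solve-∀

          D≤L-ρDD : D + ρ * (D * D) ≤ L
          D≤L-ρDD = ≤-trans (eq (γ * D) D (ρ * (D * D)) ⊢ 0≤* {γ} (+≤+ z≤n) 0≤D) L-large
            where
            eq : ∀ a b c → (a + b + c) - (b + c) ≡ a
            eq = solve-∀

          c₁≤L : c₁ ℕ.≤ length R
          c₁≤L = drop‿+≤+ (≤-trans (≤-reflexive +c₁) (≤-trans (eq C₁ ρ (ρ * (D * D)) ⊢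
            0≤+ {ρ} (+≤+ z≤n) (0≤* {ρ} (+≤+ z≤n) (0≤square D))) D≤L-ρDD))
            where
            eq : ∀ c ρ x → (c + ρ + x) - c ≡ ρ + x
            eq = solve-∀

          L≡ : L ≡ + s + C₁
          L≡ = trans (cong +_ (sym (ℕ.m∸n+n≡m c₁≤L))) (cong (_+_ (+ s)) +c₁)

          s≡ : + s ≡ + (s % r) + ρ * + q
          s≡ = trans (cong +_ (m≡m%n+[m/n]*n s r)) (cong (_+_ (+ (s % r))) (trans (pos-* q r) (ℤ.*-comm (+ q) ρ)))

          L≤ : L ≤ ρ * + q + D
          L≤ = bound L (+ s) (+ (s % r)) (ρ * + q) C₁ L≡ s≡ (+≤+ (ℕ.<⇒≤ (m%n<n s r)))
            where
            bound : ∀ L s m x c → L ≡ s + c → s ≡ m + x → m ≤ ρ → L ≤ x + (c + ρ)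
            bound L s m x c refl refl h = eq ρ m x c ⊢ gap h
              where
              eq : ∀ ρ m x c → (x + (c + ρ)) - (m + x + c) ≡ ρ - m
              eq = solve-∀

          ≤L : ρ * + q + C₁ ≤ L
          ≤L = bound L (+ s) (+ (s % r)) (ρ * + q) C₁ L≡ s≡ (+≤+ z≤n)
            where
            bound : ∀ L s m x c → L ≡ s + c → s ≡ m + x → 0ℤ ≤ m → x + c ≤ L
            bound L s m x c refl refl h = eq m x c ⊢ h
              where
              eq : ∀ m x c → (m + x + c) - (x + c) ≡ m
              eq = solve-∀

          DD≤q : D * D ≤ + q
          DD≤q = cancel-*ˡ-≤ ρ (+≤+ 1≤r) (cancel D (ρ * (D * D)) (ρ * + q) (≤-trans D≤L-ρDD L≤))
            where
            cancel : ∀ d x y → d + x ≤ y + d → x ≤ y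
            cancel d x y h = eq d x y ⊢ gap h
              where
              eq : ∀ d x y → y - x ≡ (y + d) - (d + x)
              eq = solve-∀

          1≤q : 1ℤ ≤ + q
          1≤q = ≤-trans (1≤* (1≤D 1≤r) (1≤D 1≤r)) DD≤q

          1≤N : 1ℤ ≤ N
          1≤N = +≤+ (subst (1 ℕ.≤_) (sym |V|) (ℕ.≤-trans (s≤s z≤n) large))

          N≤γL : N ≤ γ * L
          N≤γL = ≤-trans (+≤+ (subst (ℕ._≤ g ℕ.* length R) (sym |V|) (ℕ.<⇒≤ unfinished))) (≤-reflexive (pos-* g (length R)))

          k≤n : k ℕ.≤ n
          k≤n = ℕ.≤-trans (ℕ.m≤m*n k r) (ℕ.≤-trans (ℕ.m≤n+m _ (length R)) (ℕ.≤-reflexive count-≡))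

          -- There are at most `n` disjoint tiles, so the accumulated increase is at most K N⁴.
          Φ≤ : Φ R ≤ K * (N * N * (N * N))
          Φ≤ = bound (+ k) K N (Φ R) (+≤+ (subst (k ℕ.≤_) (sym |V|) k≤n)) (+≤+ z≤n) 0≤K potential
            where
            bound : ∀ k K N F → k ≤ N → 0ℤ ≤ N → 0ℤ ≤ K → F ≤ k * (K * (N * N * N)) → F ≤ K * (N * N * (N * N))
            bound k K N F k≤N 0≤N 0≤K h = eq k K N F ⊢
              0≤+ (gap h) (0≤* (gap k≤N) (0≤* 0≤K (0≤* (0≤square N) 0≤N)))
              where
              eq : ∀ k K N F → K * (N * N * (N * N)) - F ≡ (k * (K * (N * N * N)) - F) + (N - k) * (K * (N * N * N))
              eq = solve-∀

        extend : Step R → Progress k R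
        extend (mkStep T W σ trn |T| Φ-W) = W , shorter , record
          { tiling    = proj₁ extended
          ; covered   = covered ++ T
          ; partition = ↭-trans partition (↭-trans (++⁺ˡ covered σ) (↭-sym (++-assoc covered T W)))
          ; avoids    = proj₂ extended
          ; count-≡   = trans (trans (sym (ℕ.+-assoc (length W) r (k ℕ.* r)))
              (cong (ℕ._+ k ℕ.* r) (trans (ℕ.+-comm (length W) r) (sym |R|)))) count-≡
          ; potential = bound (+ k) (K * (N * N * N)) (Φ R) (Φ W) potential Φ-W
          }
          where
          extended = add-tile T W tiling trn |T| (λ p → avoids p ∘ ∈-resp-↭ (↭-sym σ))
            (Unique-disjoint T (Unique-resp-↭ σ (Unique-↭ʳ covered partition uniq)))
          |R| : length R ≡ r ℕ.+ length W
          |R| = trans (↭-length σ) (trans (length-++ T) (cong (ℕ._+ length W) |T|))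
          shorter : length W ℕ.< length R
          shorter = subst (suc (length W) ℕ.≤_) (sym |R|) (ℕ.+-monoˡ-≤ (length W) 1≤r)
          bound : ∀ k K F F′ → F ≤ k * K → F′ ≤ F + K → F′ ≤ (1ℤ + k) * K
          bound k K F F′ h h′ = eq k K F F′ ⊢ 0≤+ (gap h) (gap h′)
            where
            eq : ∀ k K F F′ → (1ℤ + k) * K - F′ ≡ (k * K - F) + (F + K - F′)
            eq = solve-∀

        advance : Progress k R
        advance = extend (step q covered R partition uniq 2≤r 1≤N Φ≤ N≤γL γD≤L L≤ ≤L 1≤q DD≤q)

      Result = Σ ℕ λ k → Tiling G r k × g ℕ.* (n ℕ.∸ k ℕ.* r) ℕ.≤ n

      -- Every tile shortens the remainder, so its length bounds the number of rounds. The process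
      -- stops once at most `n/g` vertices remain.
      exhaust : ∀ fuel {k R} → length R ℕ.≤ fuel → State k R → Result
      exhaust fuel {k} {R} R≤ st = decide (n ℕ.<? g ℕ.* length R)
        where
        open State st
        continue : ∀ fuel → length R ℕ.≤ fuel → Progress k R → Result
        continue zero       R≤ (_ , W< , _)   = ⊥-elim (ℕ.n≮0 (ℕ.≤-trans W< R≤))
        continue (suc fuel) R≤ (_ , W< , st′) = exhaust fuel (ℕ.s≤s⁻¹ (ℕ.≤-trans W< R≤)) st′
        decide : Dec (n ℕ.< g ℕ.* length R) → Result
        decide (yes unfinished) = continue fuel R≤ (advance st unfinished)
        decide (no  finished)   = k , tiling , subst (λ m → g ℕ.* m ℕ.≤ n)
          (sym (trans (cong (ℕ._∸ k ℕ.* r) (sym count-≡)) (ℕ.m+n∸n≡m (length R) (k ℕ.* r)))) (ℕ.≮⇒≥ finished)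

      almost-perfect : Result
      almost-perfect = exhaust (length V) ℕ.≤-refl initial

-- From rational bounds to inequalities of natural numbers, and back.

module RationalBounds where

  open import Data.Integer as ℤ using (+_)
  import Data.Integer.Properties as ℤ
  open import Data.Integer.Tactic.RingSolver using (solve-∀)
  open import Data.Nat as ℕ using (ℕ; suc; z≤n)
  import Data.Nat.Properties as ℕ
  open import Data.Rational
  open import Data.Rational.Properties
  open import Data.Rational.Solver using (module +-*-Solver)
  open import Data.Rational.Unnormalised as ℚᵘ using (mkℚᵘ; *≡*; *≤*)
  import Data.Rational.Unnormalised.Properties as ℚᵘ
  open import Relation.Binary.PropositionalEquality using (_≡_; refl; sym; trans; cong; cong₂; subst)

  ℕ→ℚ-≃ : ∀ n → toℚᵘ (ℕ→ℚ n) ℚᵘ.≃ mkℚᵘ (+ n) 0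
  ℕ→ℚ-≃ n = toℚᵘ-fromℚᵘ (mkℚᵘ (+ n) 0)

  ℕ→ℚ-+ : ∀ m n → ℕ→ℚ (m ℕ.+ n) ≡ ℕ→ℚ m + ℕ→ℚ n
  ℕ→ℚ-+ m n = toℚᵘ-injective (ℚᵘ.≃-trans (ℕ→ℚ-≃ (m ℕ.+ n)) (ℚᵘ.≃-trans (*≡* (eq (+ m) (+ n)))
    (ℚᵘ.≃-sym (ℚᵘ.≃-trans (toℚᵘ-homo-+ (ℕ→ℚ m) (ℕ→ℚ n)) (ℚᵘ.+-cong (ℕ→ℚ-≃ m) (ℕ→ℚ-≃ n))))))
    where
    eq : ∀ m n → (m ℤ.+ n) ℤ.* + 1 ≡ (m ℤ.* + 1 ℤ.+ n ℤ.* + 1) ℤ.* + 1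
    eq = solve-∀

  ℕ→ℚ-* : ∀ m n → ℕ→ℚ (m ℕ.* n) ≡ ℕ→ℚ m * ℕ→ℚ n
  ℕ→ℚ-* m n = toℚᵘ-injective (ℚᵘ.≃-trans (ℕ→ℚ-≃ (m ℕ.* n)) (ℚᵘ.≃-trans (*≡* (cong (ℤ._* + 1) (ℤ.pos-* m n)))
    (ℚᵘ.≃-sym (ℚᵘ.≃-trans (toℚᵘ-homo-* (ℕ→ℚ m) (ℕ→ℚ n)) (ℚᵘ.*-cong (ℕ→ℚ-≃ m) (ℕ→ℚ-≃ n))))))

  ℕ→ℚ-mono : ∀ {m n} → m ℕ.≤ n → ℕ→ℚ m ≤ ℕ→ℚ n
  ℕ→ℚ-mono {m} {n} m≤n = toℚᵘ-cancel-≤ (ℚᵘ.≤-respˡ-≃ (ℚᵘ.≃-sym (ℕ→ℚ-≃ m)) (ℚᵘ.≤-respʳ-≃ (ℚᵘ.≃-sym (ℕ→ℚ-≃ n))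
    (*≤* (ℤ.*-monoʳ-≤-nonNeg (+ 1) (ℤ.+≤+ m≤n)))))

  ℕ→ℚ-cancel : ∀ {m n} → ℕ→ℚ m ≤ ℕ→ℚ n → m ℕ.≤ n
  ℕ→ℚ-cancel {m} {n} le with ℚᵘ.≤-respˡ-≃ (ℕ→ℚ-≃ m) (ℚᵘ.≤-respʳ-≃ (ℕ→ℚ-≃ n) (toℚᵘ-mono-≤ le))
  ... | *≤* h = ℤ.drop‿+≤+ (ℤ.*-cancelʳ-≤-pos (+ m) (+ n) (+ 1) h)

  0≤ℕ→ℚ : ∀ n → 0ℚ ≤ ℕ→ℚ n
  0≤ℕ→ℚ n = ℕ→ℚ-mono {0} {n} z≤n

  *-inv : ∀ r → 1 ℕ.≤ r → ℕ→ℚ r * inv r ≡ 1ℚ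
  *-inv (suc k) _ = toℚᵘ-injective (ℚᵘ.≃-trans (toℚᵘ-homo-* (ℕ→ℚ (suc k)) (inv (suc k)))
    (ℚᵘ.≃-trans (ℚᵘ.*-cong (ℕ→ℚ-≃ (suc k)) (toℚᵘ-fromℚᵘ (mkℚᵘ (+ 1) k))) (*≡* (eq (+ suc k)))))
    where
    eq : ∀ s → s ℤ.* + 1 ℤ.* + 1 ≡ + 1 ℤ.* (+ 1 ℤ.* s)
    eq = solve-∀

  -- The numerator of a positive `γ` is at least 1, so `γ` is at least `1/g` for its denominator
  -- `g`. The combinatorial argument runs with `1/g` in place of `γ`.
  1≤*↧ : ∀ γ → γ > 0ℚ → 1ℚ ≤ γ * ℕ→ℚ (↧ₙ γ)
  1≤*↧ γ@(mkℚ (+ suc p) d _) _ = toℚᵘ-cancel-≤ (ℚᵘ.≤-respʳ-≃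
    (ℚᵘ.≃-sym (ℚᵘ.≃-trans (toℚᵘ-homo-* γ (ℕ→ℚ (suc d))) (ℚᵘ.*-congˡ (ℕ→ℚ-≃ (suc d)))))
    (*≤* bound))
    where
    bound : + 1 ℤ.* + (suc d ℕ.* 1) ℤ.≤ + suc p ℤ.* + suc d ℤ.* + 1
    bound = ℤ.≤-trans (ℤ.≤-reflexive (trans (ℤ.*-identityˡ _) (cong +_ (ℕ.*-identityʳ (suc d)))))
      (ℤ.≤-trans (ℤ.+≤+ (ℕ.m≤m+n (suc d) (p ℕ.* suc d))) (ℤ.≤-reflexive (sym (ℤ.*-identityʳ (+ suc p ℤ.* + suc d)))))
  1≤*↧ (mkℚ (+ 0)         _ _) (*<* (ℤ.+<+ ()))
  1≤*↧ (mkℚ (ℤ.-[1+ _ ]) _ _) (*<* ())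

  mono-*ˡ : ∀ p {q s} → 0ℚ ≤ p → q ≤ s → p * q ≤ p * s
  mono-*ˡ p 0≤p = *-monoˡ-≤-nonNeg p ⦃ nonNegative 0≤p ⦄

  scaled-≤ : ∀ γ → γ > 0ℚ → ∀ m n → ↧ₙ γ ℕ.* m ℕ.≤ n → ℕ→ℚ m ≤ γ * ℕ→ℚ n
  scaled-≤ γ γ>0 m n gm≤n = begin
    M             ≡⟨ *-identityʳ M ⟨
    M * 1ℚ        ≤⟨ mono-*ˡ M (0≤ℕ→ℚ m) (1≤*↧ γ γ>0) ⟩
    M * (γ * g)   ≡⟨ solve 3 (λ M γ g → M :* (γ :* g) := γ :* (g :* M)) refl M γ g ⟩
    γ * (g * M)   ≡⟨ cong (γ *_) (ℕ→ℚ-* (↧ₙ γ) m) ⟨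
    γ * ℕ→ℚ (↧ₙ γ ℕ.* m) ≤⟨ mono-*ˡ γ (<⇒≤ γ>0) (ℕ→ℚ-mono gm≤n) ⟩
    γ * ℕ→ℚ n     ∎
    where
    open ≤-Reasoning
    open +-*-Solver
    M = ℕ→ℚ m
    g = ℕ→ℚ (↧ₙ γ)

  -- Weakening `γ` to `1/g` in the degree condition and multiplying by `r * g` clears all
  -- denominators; the term with `inv r` moves to the other side.
  degree-bound : ∀ r γ → 1 ℕ.≤ r → γ > 0ℚ → ∀ n d →
    (1ℚ - inv r + γ) * ℕ→ℚ n ≤ ℕ→ℚ d →
    r ℕ.* ↧ₙ γ ℕ.* n ℕ.+ r ℕ.* n ℕ.≤ r ℕ.* ↧ₙ γ ℕ.* d ℕ.+ ↧ₙ γ ℕ.* n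
  degree-bound r γ 1≤r γ>0 n d h = ℕ→ℚ-cancel (begin
    ℕ→ℚ (r ℕ.* g ℕ.* n ℕ.+ r ℕ.* n)
      ≡⟨ trans (ℕ→ℚ-+ (r ℕ.* g ℕ.* n) (r ℕ.* n)) (cong₂ _+_ (triple n) (ℕ→ℚ-* r n)) ⟩
    R * G * N + R * N
      ≡⟨ solve 3 (λ R G N → R :* G :* N :+ R :* N :=
           (R :* G :* N :- con 1ℚ :* (G :* N) :+ G :* N) :+ R :* N :* con 1ℚ) refl R G N ⟩
    (R * G * N - 1ℚ * (G * N) + G * N) + R * N * 1ℚ
      ≤⟨ +-monoʳ-≤ (R * G * N - 1ℚ * (G * N) + G * N) (mono-*ˡ (R * N) 0≤RN (1≤*↧ γ γ>0)) ⟩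
    (R * G * N - 1ℚ * (G * N) + G * N) + R * N * (γ * G)
      ≡⟨ cong (λ x → (R * G * N - x * (G * N) + G * N) + R * N * (γ * G)) (*-inv r 1≤r) ⟨
    (R * G * N - R * i * (G * N) + G * N) + R * N * (γ * G)
      ≡⟨ solve 5 (λ R G N i γ → (R :* G :* N :- R :* i :* (G :* N) :+ G :* N) :+ R :* N :* (γ :* G) :=
           R :* G :* ((con 1ℚ :- i :+ γ) :* N) :+ G :* N) refl R G N i γ ⟩
    R * G * ((1ℚ - i + γ) * N) + G * N
      ≤⟨ +-monoˡ-≤ (G * N) (mono-*ˡ (R * G) 0≤RG h) ⟩
    R * G * ℕ→ℚ d + G * N
      ≡⟨ trans (ℕ→ℚ-+ (r ℕ.* g ℕ.* d) (g ℕ.* n)) (cong₂ _+_ (triple d) (ℕ→ℚ-* g n)) ⟨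
    ℕ→ℚ (r ℕ.* g ℕ.* d ℕ.+ g ℕ.* n) ∎)
    where
    open ≤-Reasoning
    open +-*-Solver
    g = ↧ₙ γ
    R = ℕ→ℚ r
    G = ℕ→ℚ g
    N = ℕ→ℚ n
    i = inv r
    0≤RN : 0ℚ ≤ R * N
    0≤RN = subst (0ℚ ≤_) (ℕ→ℚ-* r n) (0≤ℕ→ℚ (r ℕ.* n))
    0≤RG : 0ℚ ≤ R * G
    0≤RG = subst (0ℚ ≤_) (ℕ→ℚ-* r g) (0≤ℕ→ℚ (r ℕ.* g))
    triple : ∀ n → ℕ→ℚ (r ℕ.* g ℕ.* n) ≡ R * G * ℕ→ℚ n
    triple n = trans (ℕ→ℚ-* (r ℕ.* g) n) (cong (_* ℕ→ℚ n) (ℕ→ℚ-* r g))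

-- Dominant neighbourhoods and their complements.

module DominantNeighbourhood where

  open import Data.Bool using (Bool; true; false; not)
  open import Data.Fin using (Fin)
  open import Data.Integer using (+_; 0ℤ; 1ℤ; _+_)
  open import Data.Integer.Tactic.RingSolver using (solve-∀)
  open import Data.List using (tabulate; allFin)
  open import Data.Nat as ℕ using (zero; suc)
  open import Data.Nat.Properties using (m≥n⇒m⊔n≡m; m≤n⇒m⊔n≡n; ≤-total)
  open import Data.Sum using (_⊎_; inj₁; inj₂)
  open import Function using (_∘_; id)
  open import Relation.Binary.PropositionalEquality using (_≡_; refl; sym; trans; cong)
  open ListSums

  count-not : ∀ {A : Set} {n} (p : A → Bool) (h : Fin n → A) →
    count (not ∘ p) (tabulate h) + + countᵇ (p ∘ h) ≡ + n
  count-not {n = zero}  p h = refl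
  count-not {n = suc n} p h with p (h Fin.zero)
  ... | true  = trans (eq (count (not ∘ p) (tabulate (h ∘ Fin.suc))) (+ countᵇ (p ∘ h ∘ Fin.suc)))
                  (cong (_+_ 1ℤ) (count-not p (h ∘ Fin.suc)))
    where
    eq : ∀ a b → (0ℤ + a) + (1ℤ + b) ≡ 1ℤ + (a + b)
    eq = solve-∀
  ... | false = trans (eq (count (not ∘ p) (tabulate (h ∘ Fin.suc))) (+ countᵇ (p ∘ h ∘ Fin.suc)))
                  (cong (_+_ 1ℤ) (count-not p (h ∘ Fin.suc)))
    where
    eq : ∀ a b → (1ℤ + a) + b ≡ 1ℤ + (a + b)
    eq = solve-∀

  module _ {n} (G : Digraph n) where

    Dominance : Fin n → Set
    Dominance z = indeg G z ℕ.≤ outdeg G z ⊎ outdeg G z ℕ.≤ indeg G z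

    dominance : ∀ z → Dominance z
    dominance z = ≤-total (indeg G z) (outdeg G z)

    dominant : ∀ {z} → Dominance z → Fin n → Bool
    dominant {z} (inj₁ _) v = adj G z v
    dominant {z} (inj₂ _) v = adj G v z

    -- This is the `M` of the tiling argument. The set contains `z` itself, which has no loop.
    outside : Fin n → Fin n → Bool
    outside z = not ∘ dominant (dominance z)

    not-false : ∀ {b} → not b ≡ false → b ≡ true
    not-false {true} _ = refl

    dominates : ∀ z → (∀ v → outside z v ≡ false → Edge G z v) ⊎ (∀ v → outside z v ≡ false → Edge G v z)
    dominates z with dominance z
    ... | inj₁ _ = inj₁ (λ _ → not-false)
    ... | inj₂ _ = inj₂ (λ _ → not-false)

    countᵇ-dominant : ∀ {z} (d : Dominance z) → countᵇ (dominant d) ≡ domdeg G z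
    countᵇ-dominant (inj₁ in≤out) = sym (m≥n⇒m⊔n≡m in≤out)
    countᵇ-dominant (inj₂ out≤in) = sym (m≤n⇒m⊔n≡n out≤in)

    count-outside : ∀ z → count (outside z) (allFin n) + + domdeg G z ≡ + n
    count-outside z = trans
      (cong (λ d → count (outside z) (allFin n) + + d) (sym (countᵇ-dominant (dominance z))))
      (count-not (dominant (dominance z)) id)

-- Translation of the hypotheses and proof of the theorem.

open import Data.Nat using (ℕ; _≤_; _∸_; _*_)
open import Data.Fin using (Fin)
open import Data.Product using (Σ; _×_)
open import Data.Sum using (_⊎_)
open import Data.Rational using (ℚ; _+_; _-_; _>_; 0ℚ; 1ℚ) renaming (_*_ to _*ℚ_; _≤_ to _≤ℚ_)
open import Relation.Binary.PropositionalEquality using (_≢_)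

open import Data.Empty using (⊥-elim)
open import Data.Integer as ℤ using (+_)
import Data.Integer.Properties as ℤ
open import Data.Integer.Tactic.RingSolver using (solve-∀)
open import Data.List using (allFin)
open import Data.List.Properties using (length-tabulate)
import Data.Nat.Properties as ℕ
open import Data.Product using (_,_)
open import Data.Rational using (_≤?_; ↧ₙ_)
open import Data.Sum using (inj₁; inj₂)
open import Function using (id)
open import Relation.Binary.PropositionalEquality using (_≡_; refl; sym; trans; cong; cong₂)
open import Relation.Nullary using (¬_; ¬?)
open import Relation.Nullary.Decidable using (decidable-stable)

theorem6p1 : (r : ℕ) → 2 ≤ r → (γ : ℚ) → γ > 0ℚ →
    Σ ℕ λ n₀ → (n : ℕ) → n₀ ≤ n → (G : Digraph n) →
    ((x y : Fin n) → x ≢ y →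
    (Edge G x y × Edge G y x)
    ⊎ (((1ℚ - inv r + γ) *ℚ ℕ→ℚ n ≤ℚ ℕ→ℚ (domdeg G x))
    ⊎ ((1ℚ - inv r + γ) *ℚ ℕ→ℚ n ≤ℚ ℕ→ℚ (domdeg G y)))) →
    Σ ℕ λ k → Σ (Tiling G r k) λ _ → ℕ→ℚ (n ∸ k * r) ≤ℚ γ *ℚ ℕ→ℚ n
theorem6p1 r 2≤r γ γ>0 = GreedyTiling.threshold r g , λ n large G ore →
  let
    Large : Fin n → Set
    Large z = (1ℚ - inv r + γ) *ℚ ℕ→ℚ n ≤ℚ ℕ→ℚ (domdeg G z)

    large? = λ z → (1ℚ - inv r + γ) *ℚ ℕ→ℚ n ≤? ℕ→ℚ (domdeg G z)

    -- If neither endpoint has large dominant degree, only alternative (i) is left.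
    complete : ∀ {u v} → u ≢ v → ¬ Large u → ¬ Large v → Edge G u v
    complete {u} {v} u≢v ¬u ¬v = case-ore (ore u v u≢v) ¬u ¬v

    k , τ , few = GreedyTiling.almost-perfect G (outside G) (dominates G)
      (λ z → ¬ Large z) (λ z → ¬? (large? z)) complete r g 2≤r 1≤g large
      -- Comparison of rationals is decidable, so a vertex that is not small has large dominant
      -- degree.
      (λ z ¬¬large → outside-bound n (domdeg G z) (ListSums.count (outside G z) (allFin n)) (ListSums.len (allFin n))
        (cong +_ (length-tabulate id)) (count-outside G z)
        (RationalBounds.degree-bound r γ (ℕ.<⇒≤ 2≤r) γ>0 n (domdeg G z) (decidable-stable (large? z) ¬¬large)))
  in k , τ , RationalBounds.scaled-≤ γ γ>0 (n ∸ k * r) n few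
  where
  open DominantNeighbourhood
  open ListSums using (_⊢_; gap)
  g = ↧ₙ γ
  1≤g : 1 ≤ g
  1≤g = Data.Nat.s≤s Data.Nat.z≤n
  case-ore : ∀ {A B C D : Set} → (A × B) ⊎ (C ⊎ D) → ¬ C → ¬ D → A
  case-ore (inj₁ (a , _))  _  _  = a
  case-ore (inj₂ (inj₁ c)) ¬c _  = ⊥-elim (¬c c)
  case-ore (inj₂ (inj₂ d)) _  ¬d = ⊥-elim (¬d d)
  -- Substituting `d = n - m` turns the lower bound on the dominant degree into the upper bound on
  -- the number of missed vertices.
  outside-bound : ∀ n d m N → N ≡ + n → m ℤ.+ + d ≡ + n →
    r * g * n Data.Nat.+ r * n ≤ r * g * d Data.Nat.+ g * n →
    + r ℤ.* + g ℤ.* m ℤ.+ + r ℤ.* N ℤ.≤ + g ℤ.* N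
  outside-bound n d m N refl m+d≡n h = eq (+ r) (+ g) m (+ d) (+ n) m+d≡n ⊢ gap (ℤ.≤-trans (ℤ.≤-reflexive (sym (hom n n r)))
      (ℤ.≤-trans (ℤ.+≤+ h) (ℤ.≤-reflexive (hom d n g))))
    where
    hom : ∀ a b c → + (r * g * a Data.Nat.+ c * b) ≡ + r ℤ.* + g ℤ.* + a ℤ.+ + c ℤ.* + b
    hom a b c = cong₂ ℤ._+_ (trans (ℤ.pos-* (r * g) a) (cong (ℤ._* + a) (ℤ.pos-* r g))) (ℤ.pos-* c b)
    eq′ : ∀ r g m d → g ℤ.* (m ℤ.+ d) ℤ.- (r ℤ.* g ℤ.* m ℤ.+ r ℤ.* (m ℤ.+ d)) ≡
      (r ℤ.* g ℤ.* d ℤ.+ g ℤ.* (m ℤ.+ d)) ℤ.- (r ℤ.* g ℤ.* (m ℤ.+ d) ℤ.+ r ℤ.* (m ℤ.+ d))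
    eq′ = solve-∀
    eq : ∀ r g m d n → m ℤ.+ d ≡ n → g ℤ.* n ℤ.- (r ℤ.* g ℤ.* m ℤ.+ r ℤ.* n) ≡
      (r ℤ.* g ℤ.* d ℤ.+ g ℤ.* n) ℤ.- (r ℤ.* g ℤ.* n ℤ.+ r ℤ.* n)
    eq r g m d n refl = eq′ r g m d
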